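{- Let $n \geq 2$ and let $\mathbb{F}_q$ be a finite field. Every nonzero element of $\operatorname{Mat}_n(\mathbb{F}_q)$ can be written as a sum of two matrices in $\operatorname{SL}_n(\mathbb{F}_q)$. If $n$ is even or $\operatorname{char}(\mathbb{F}_q) = 2$, then the zero matrix can be written as a sum of two matrices in $\operatorname{SL}_n(\mathbb{F}_q)$; otherwise the zero matrix cannot be written as a sum of two matrices in $\operatorname{SL}_n(\mathbb{F}_q)$ but can be written as a sum of three.
   Context: $\operatorname{SL}_n(\mathbb{F}_q)$ is the set of $n\times n$ matrices over $\mathbb{F}_q$ of determinant $1$. -}

module Defs where

open import Algebra.Bundles using (CommutativeRing; Semiring)
import Algebra.Definitions
import Algebra.Definitions.RawSemiring
open import Data.Fin.Base using (Fin; zero; suc; toℕ; punchIn)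
open import Data.Nat.Base using (ℕ; zero; suc)
open import Data.Nat.Divisibility using (_∣_)
open import Data.Product.Base using (_×_; ∃-syntax)
open import Data.Vec.Functional using (Vector)
open import Function.Bundles using (Inverse; _⇔_)
open import Level using (Level; _⊔_) renaming (suc to lsuc)
import Relation.Binary.PropositionalEquality.Properties as ≡
open import Relation.Nullary.Negation.Core using (¬_)
open import Relation.Unary using (Pred; _∈_)

record FiniteField (c ℓ : Level) : Set (lsuc (c ⊔ ℓ)) where
  field
    commutativeRing : CommutativeRing c ℓ

  open CommutativeRing commutativeRing public
  open Algebra.Definitions _≈_ using (Invertible)

  field
    1≉0        : ¬ (1# ≈ 0#)
    invertible : ∀ x → ¬ (x ≈ 0#) → Invertible 1# _*_ x
    order      : ℕ
    finite     : Inverse setoid (≡.setoid (Fin order))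

module Matrices {c ℓ : Level} (R : CommutativeRing c ℓ) where

  open CommutativeRing R hiding (zero)
  private
    module RS = Algebra.Definitions.RawSemiring (Semiring.rawSemiring semiring)

  -- The kernel of the unique ring homomorphism ℤ → R is pℤ; it is enough to
  -- test natural numbers, since the kernel is closed under negation.
  HasCharacteristic : ℕ → Set ℓ
  HasCharacteristic p = ∀ m → (m RS.× 1# ≈ 0#) ⇔ (p ∣ m)

  Mat : ℕ → Set c
  Mat n = Vector (Vector Carrier n) n

  infix  4 _≈ᴹ_
  infixl 6 _+ᴹ_

  _≈ᴹ_ : ∀ {n} → Mat n → Mat n → Set ℓ
  A ≈ᴹ B = ∀ i j → A i j ≈ B i j

  0ᴹ : ∀ {n} → Mat n
  0ᴹ i j = 0#

  _+ᴹ_ : ∀ {n} → Mat n → Mat n → Mat n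
  (A +ᴹ B) i j = A i j + B i j

  minor : ∀ {n} → Fin (suc n) → Mat (suc n) → Mat n
  minor k A i j = A (suc i) (punchIn k j)

  -- Laplace expansion along the first row.
  det : ∀ {n} → Mat n → Carrier
  det {zero}  A = 1#
  det {suc n} A = RS.sum λ k → (- 1#) RS.^ toℕ k * (A zero k * det (minor k A))

  SL : ∀ n → Pred (Mat n) ℓ
  SL n A = det A ≈ 1#

  SumOfTwoSL : ∀ {n} → Mat n → Set (c ⊔ ℓ)
  SumOfTwoSL {n} A =
    ∃[ B ] ∃[ C ] B ∈ SL n × C ∈ SL n × A ≈ᴹ B +ᴹ C

  SumOfThreeSL : ∀ {n} → Mat n → Set (c ⊔ ℓ)
  SumOfThreeSL {n} A =
    ∃[ B ] ∃[ C ] ∃[ D ] B ∈ SL n × C ∈ SL n × D ∈ SL n × A ≈ᴹ B +ᴹ C +ᴹ D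

{-# OPTIONS --safe #-}

-- A matrix with diagonal d + e is the sum of a lower triangular matrix with
-- diagonal d and an upper triangular one with diagonal e. With d = (1,…,1) and
-- e = (−1,…,−1) this settles matrices with zero diagonal when n is even; with
-- e = (1,−1,…,−1) it settles matrices with diagonal (2,0,…,0) when n is odd.
-- Row and column transvections preserve being a sum of two elements of SL, and
-- they bring any matrix (n even), respectively any nonzero matrix (n odd), to
-- this shape: a nonzero matrix of size at least 2 can be given any prescribed
-- top-left entry, after which operations on the remaining rows and columns
-- leave that entry alone. Conversely, if B + C = 0 with n odd, then
-- 1 = det C = − det B = − 1.

module Submission where

open import Defs
open import Algebra.Bundles using (CommutativeRing)
import Algebra.Properties.Monoid.Mult
import Algebra.Properties.Monoid.Sum
import Algebra.Properties.Ring
import Algebra.Properties.Semiring.Exp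
import Algebra.Properties.Semiring.Sum
import Algebra.Solver.Ring.NaturalCoefficients.Default
open import Data.Bool.Base using (if_then_else_)
open import Data.Fin.Base using (Fin; zero; suc; toℕ; punchIn)
open import Data.Fin.Properties using (_≟_; all?; suc-injective; ¬∀⟶∃¬)
open import Data.Nat.Base using (ℕ; zero; suc; _≤_; s≤s)
open import Data.Nat.Divisibility using (_∣_; divides; ∣-refl; ∣m∣n⇒∣m+n; ∣1⇒≡1)
open import Data.Product.Base using (_×_; _,_; ∃-syntax)
open import Data.Sum.Base using (_⊎_; inj₁; inj₂; [_,_]′; fromInj₂)
open import Data.Vec.Functional using (Vector; _∷_; replicate; tail; transpose)
open import Function.Base using (_∘_)
open import Function.Bundles using (Equivalence; mk⇔)
open import Function.Properties.Inverse using (Inverse⇒Injection)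
open import Level using (Level)
open import Relation.Binary.Definitions using (Decidable)
open import Relation.Binary.PropositionalEquality.Core as ≡ using (_≡_; _≢_)
import Relation.Binary.Reasoning.Setoid
open import Relation.Nullary.Decidable using (Dec; does; yes; no; via-injection)
open import Relation.Nullary.Negation.Core using (¬_; contradiction)

private
  variable
    n : ℕ

-- Parity of consecutive numbers.

2∣-or-pred : ∀ n → 2 ∣ suc n ⊎ 2 ∣ n
2∣-or-pred zero    = inj₂ (divides 0 ≡.refl)
2∣-or-pred (suc n) = [ inj₂ , inj₁ ∘ ∣m∣n⇒∣m+n ∣-refl ]′ (2∣-or-pred n)

2∣-pred : ¬ 2 ∣ suc n → 2 ∣ n
2∣-pred {n} 2∤1+n = fromInj₂ (λ 2∣1+n → contradiction 2∣1+n 2∤1+n) (2∣-or-pred n)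

-- Determinants over a commutative ring: transposition, row linearity, alternation.

module Determinant {c ℓ : Level} (R : CommutativeRing c ℓ) where

  open CommutativeRing R hiding (zero)
  open Matrices R
  open Algebra.Properties.Semiring.Sum semiring
  open Algebra.Properties.Semiring.Exp semiring
  open Algebra.Properties.Ring ring
  open Algebra.Solver.Ring.NaturalCoefficients.Default commutativeSemiring
    using (solve; _:=_; _:+_; _:*_; con)
  open Relation.Binary.Reasoning.Setoid setoid

  private
    module + = Algebra.Properties.Monoid.Mult +-monoid

    cofactor : Mat (suc n) → Fin (suc n) → Carrier
    cofactor A k = (- 1#) ^ toℕ k * (A zero k * det (minor k A))

  -1*-1*x≈x : ∀ x → - 1# * (- 1# * x) ≈ x
  -1*-1*x≈x x = begin
    - 1# * (- 1# * x)  ≈⟨ -1*x≈-x _ ⟩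
    - (- 1# * x)       ≈⟨ -‿cong (-1*x≈-x x) ⟩
    - - x              ≈⟨ -‿involutive x ⟩
    x                  ∎

  sum-zero : (f : Vector Carrier n) → (∀ k → f k ≈ 0#) → sum f ≈ 0#
  sum-zero {n} f f≈0 = trans (sum-cong-≋ f≈0) (sum-replicate-zero n)

  sum-linear : ∀ m (f g : Vector Carrier n) →
               sum (λ k → f k + m * g k) ≈ sum f + m * sum g
  sum-linear m f g = trans (∑-distrib-+ f (λ k → m * g k)) (+-congˡ (sym (*-distribˡ-sum m g)))

  det-cong : {A B : Mat n} → A ≈ᴹ B → det A ≈ det B
  det-cong {zero}  A≈B = refl
  det-cong {suc n} A≈B = sum-cong-≋ λ k → *-congˡ {(- 1#) ^ toℕ k}
    (*-cong (A≈B zero k) (det-cong λ i j → A≈B (suc i) (punchIn k j)))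

  det-scale : ∀ m (A : Mat n) → det (λ i j → m * A i j) ≈ m ^ n * det A
  det-scale {zero}  m A = sym (*-identityˡ 1#)
  det-scale {suc n} m A = begin
    sum (cofactor (λ i j → m * A i j))
      ≈⟨ sum-cong-≋ (λ k → *-congˡ {(- 1#) ^ toℕ k} (*-congˡ {m * A zero k} (det-scale m (minor k A)))) ⟩
    sum (λ k → (- 1#) ^ toℕ k * (m * A zero k * (m ^ n * det (minor k A))))
      ≈⟨ sum-cong-≋ (λ k → solve 5 (λ s m a p d → s :* (m :* a :* (p :* d)) := m :* p :* (s :* (a :* d)))
           refl ((- 1#) ^ toℕ k) m (A zero k) (m ^ n) (det (minor k A))) ⟩
    sum (λ k → m ^ suc n * cofactor A k)
      ≈⟨ *-distribˡ-sum (m ^ suc n) (cofactor A) ⟨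
    m ^ suc n * det A ∎

  -- Expanding the minors along their first columns as well makes det A a double
  -- sum in which A and its transpose play symmetric roles.
  det-transpose : (A : Mat n) → det (transpose A) ≈ det A
  det-transpose {zero}        A = refl
  det-transpose {suc zero}    A = refl
  det-transpose {suc (suc n)} A = begin
    det (transpose A)
      ≈⟨ expand (transpose A) (λ k → det-transpose (minor (suc k) (transpose A))) ⟩
    1# * (A zero zero * det (transpose (minor zero A))) + sum (λ k → sum (term (transpose A) k))
      ≈⟨ +-cong (*-congˡ (*-congˡ (det-transpose (minor zero A)))) (∑-comm (term (transpose A))) ⟩
    1# * (A zero zero * det (minor zero A)) + sum (λ i → sum (λ k → term (transpose A) k i))
      ≈⟨ +-congˡ (sum-cong-≋ λ i → sum-cong-≋ λ k → flip-term i k) ⟩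
    1# * (A zero zero * det (minor zero A)) + sum (λ k → sum (term A k))
      ≈⟨ expand A (λ k → det-transpose (minor (suc k) A)) ⟨
    det A ∎
    where
    -- `A` without rows `zero`, `suc i` and columns `zero`, `suc k`. By computation,
    -- `inner (transpose A) i k` is the transpose of `inner A k i`.
    inner : Mat (suc (suc n)) → Fin (suc n) → Fin (suc n) → Mat n
    inner A i k r c = A (suc (punchIn i r)) (suc (punchIn k c))

    minorTerm : Mat (suc (suc n)) → Fin (suc n) → Fin (suc n) → Carrier
    minorTerm A k i = (- 1#) ^ toℕ i * (A (suc i) zero * det (inner A i k))

    term : Mat (suc (suc n)) → Fin (suc n) → Fin (suc n) → Carrier
    term A k i = (- 1#) ^ suc (toℕ k) * (A zero (suc k) * minorTerm A k i)

    -- Expanding a transposed minor along its first row expands the minor along its first column.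
    -- `minor zero A` stays apart because it has lost column `zero`. The induction hypothesis for
    -- the larger minors enters as `det-minorᵀ`.
    expand : ∀ A → (∀ k → det (transpose (minor (suc k) A)) ≈ det (minor (suc k) A)) → det A ≈
      1# * (A zero zero * det (minor zero A)) + sum (λ k → sum (term A k))
    expand A det-minorᵀ = +-congˡ (sum-cong-≋ λ k → begin
      cofactor A (suc k)
        ≈⟨ *-congˡ (*-congˡ (det-minorᵀ k)) ⟨
      (- 1#) ^ suc (toℕ k) * (A zero (suc k) *
        sum (λ i → (- 1#) ^ toℕ i * (A (suc i) zero * det (transpose (inner A i k)))))
        ≈⟨ *-congˡ (*-congˡ (sum-cong-≋ λ i →
             *-congˡ {(- 1#) ^ toℕ i} (*-congˡ {A (suc i) zero} (det-transpose (inner A i k))))) ⟩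
      (- 1#) ^ suc (toℕ k) * (A zero (suc k) * sum (minorTerm A k))
        ≈⟨ *-congˡ (*-distribˡ-sum (A zero (suc k)) (minorTerm A k)) ⟩
      (- 1#) ^ suc (toℕ k) * sum (λ i → A zero (suc k) * minorTerm A k i)
        ≈⟨ *-distribˡ-sum ((- 1#) ^ suc (toℕ k)) (λ i → A zero (suc k) * minorTerm A k i) ⟩
      sum (term A k) ∎)

    flip-term : ∀ i k → term (transpose A) k i ≈ term A i k
    flip-term i k = begin
      term (transpose A) k i
        ≈⟨ *-congˡ (*-congˡ (*-congˡ (*-congˡ (det-transpose (inner A k i))))) ⟩
      (- 1#) ^ suc (toℕ k) * (A (suc k) zero * ((- 1#) ^ toℕ i * (A zero (suc i) * det (inner A k i))))
        ≈⟨ solve 6 (λ e s t a b d → e :* s :* (a :* (t :* (b :* d))) := e :* t :* (b :* (s :* (a :* d))))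
             refl (- 1#) ((- 1#) ^ toℕ k) ((- 1#) ^ toℕ i) (A (suc k) zero) (A zero (suc i)) (det (inner A k i)) ⟩
      term A i k ∎

  -- Row `zero` enters each cofactor as a linear factor; a lower row is a row of every minor, so
  -- induction applies. Relating three matrices entrywise, rather than updating one, lets the
  -- hypotheses pass to the minors.
  det-linear : ∀ (i : Fin n) m {A B C : Mat n} →
    (∀ k → C i k ≈ A i k + m * B i k) →
    (∀ r → r ≢ i → ∀ k → C r k ≈ A r k) →
    (∀ r → r ≢ i → ∀ k → C r k ≈ B r k) →
    det C ≈ det A + m * det B
  det-linear zero m {A} {B} {C} Cᵢ CA CB = trans (sum-cong-≋ λ k → begin
      (- 1#) ^ toℕ k * (C zero k * det (minor k C))
        ≈⟨ *-congˡ (*-congʳ (Cᵢ k)) ⟩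
      (- 1#) ^ toℕ k * ((A zero k + m * B zero k) * det (minor k C))
        ≈⟨ solve 5 (λ s a b m d → s :* ((a :+ m :* b) :* d) := s :* (a :* d) :+ m :* (s :* (b :* d)))
             refl ((- 1#) ^ toℕ k) (A zero k) (B zero k) m (det (minor k C)) ⟩
      (- 1#) ^ toℕ k * (A zero k * det (minor k C)) + m * ((- 1#) ^ toℕ k * (B zero k * det (minor k C)))
        ≈⟨ +-cong (*-congˡ (*-congˡ (det-cong λ r c → CA (suc r) (λ ()) (punchIn k c))))
                  (*-congˡ (*-congˡ (*-congˡ (det-cong λ r c → CB (suc r) (λ ()) (punchIn k c))))) ⟩
      cofactor A k + m * cofactor B k ∎)
    (sum-linear m (cofactor A) (cofactor B))
  det-linear (suc i) m {A} {B} {C} Cᵢ CA CB = trans (sum-cong-≋ λ k → begin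
      (- 1#) ^ toℕ k * (C zero k * det (minor k C))
        ≈⟨ *-congˡ (*-congˡ (det-linear i m (λ c → Cᵢ (punchIn k c))
             (λ r r≢i c → CA (suc r) (r≢i ∘ suc-injective) (punchIn k c))
             (λ r r≢i c → CB (suc r) (r≢i ∘ suc-injective) (punchIn k c)))) ⟩
      (- 1#) ^ toℕ k * (C zero k * (det (minor k A) + m * det (minor k B)))
        ≈⟨ solve 5 (λ s c p q m → s :* (c :* (p :+ m :* q)) := s :* (c :* p) :+ m :* (s :* (c :* q)))
             refl ((- 1#) ^ toℕ k) (C zero k) (det (minor k A)) (det (minor k B)) m ⟩
      (- 1#) ^ toℕ k * (C zero k * det (minor k A)) + m * ((- 1#) ^ toℕ k * (C zero k * det (minor k B)))
        ≈⟨ +-cong (*-congˡ (*-congʳ (CA zero (λ ()) k))) (*-congˡ (*-congˡ (*-congʳ (CB zero (λ ()) k)))) ⟩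
      cofactor A k + m * cofactor B k ∎)
    (sum-linear m (cofactor A) (cofactor B))

  det-minors-zero : (A : Mat (suc n)) → (∀ k → det (minor k A) ≈ 0#) → det A ≈ 0#
  det-minors-zero A minors≈0 = sum-zero (cofactor A) λ k → begin
    cofactor A k                       ≈⟨ *-congˡ (*-congˡ (minors≈0 k)) ⟩
    (- 1#) ^ toℕ k * (A zero k * 0#)   ≈⟨ *-congˡ (zeroʳ _) ⟩
    (- 1#) ^ toℕ k * 0#                ≈⟨ zeroʳ _ ⟩
    0#                                 ∎

  -- The first two cofactors have equal minors and opposite signs, so they cancel; every other minor
  -- keeps both equal columns in front.
  det-equal-columns₀₁ : (A : Mat (suc (suc n))) → (∀ i → A i zero ≈ A i (suc zero)) → det A ≈ 0#
  det-equal-columns₀₁ {n} A eq = begin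
    cofactor A zero + (cofactor A (suc zero) + sum {n} (λ k → cofactor A (suc (suc k))))
      ≈⟨ +-cong (*-congˡ (*-cong (eq zero) (det-cong minor₀≈minor₁)))
                (+-congˡ (sum-zero {n} _ (rest A eq))) ⟩
    1# * x + ((- 1#) * 1# * x + 0#)
      ≈⟨ solve 2 (λ e x → con 1 :* x :+ (e :* con 1 :* x :+ con 0) := (con 1 :+ e) :* x) refl (- 1#) x ⟩
    (1# + (- 1#)) * x
      ≈⟨ *-congʳ (-‿inverseʳ 1#) ⟩
    0# * x
      ≈⟨ zeroˡ x ⟩
    0# ∎
    where
    x : Carrier
    x = A zero (suc zero) * det (minor (suc zero) A)

    minor₀≈minor₁ : minor zero A ≈ᴹ minor (suc zero) A
    minor₀≈minor₁ i zero    = sym (eq (suc i))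
    minor₀≈minor₁ i (suc j) = refl

    rest : ∀ {n} (A : Mat (suc (suc n))) → (∀ i → A i zero ≈ A i (suc zero)) →
           ∀ k → cofactor A (suc (suc k)) ≈ 0#
    rest {suc n} A eq k = begin
      cofactor A (suc (suc k))
        ≈⟨ *-congˡ (*-congˡ (det-equal-columns₀₁ (minor (suc (suc k)) A) (eq ∘ suc))) ⟩
      (- 1#) ^ toℕ (suc (suc k)) * (A zero (suc (suc k)) * 0#)
        ≈⟨ *-congˡ (zeroʳ _) ⟩
      (- 1#) ^ toℕ (suc (suc k)) * 0#
        ≈⟨ zeroʳ _ ⟩
      0# ∎

  swap₀₁ : Fin (suc (suc n)) → Fin (suc (suc n))
  swap₀₁ zero          = suc zero
  swap₀₁ (suc zero)    = zero
  swap₀₁ (suc (suc k)) = suc (suc k)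

  -- The first two cofactors trade places and hence signs; in the others the swap happens inside the
  -- minor.
  det-swap-columns₀₁ : (A : Mat (suc (suc n))) → det (λ i j → A i (swap₀₁ j)) ≈ - 1# * det A
  det-swap-columns₀₁ {n} A = begin
    cofactor B zero + (cofactor B (suc zero) + sum {n} (λ k → cofactor B (suc (suc k))))
      ≈⟨ +-cong (*-congˡ (*-congˡ (det-cong minor₀≈minor₁)))
         (+-cong (*-congˡ (*-congˡ (det-cong minor₁≈minor₀))) (trans (sum-cong-≋ {n} (rest A)) (sym (*-distribˡ-sum {n} (- 1#) _)))) ⟩
    1# * x + (- 1# * 1# * y + - 1# * z)
      -- The semiring solver sees `- 1#` as a variable, so its square has to be introduced by hand.
      ≈⟨ +-congʳ (trans (*-identityˡ x) (sym (-1*-1*x≈x x))) ⟩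
    - 1# * (- 1# * x) + (- 1# * 1# * y + - 1# * z)
      ≈⟨ solve 4 (λ e x y z → e :* (e :* x) :+ (e :* con 1 :* y :+ e :* z) := e :* (con 1 :* y :+ (e :* con 1 :* x :+ z)))
           refl (- 1#) x y z ⟩
    - 1# * det A ∎
    where
    B : Mat (suc (suc n))
    B i j = A i (swap₀₁ j)
    x y z : Carrier
    x = A zero (suc zero) * det (minor (suc zero) A)
    y = A zero zero * det (minor zero A)
    z = sum {n} (λ k → cofactor A (suc (suc k)))

    minor₀≈minor₁ : minor zero B ≈ᴹ minor (suc zero) A
    minor₀≈minor₁ i zero    = refl
    minor₀≈minor₁ i (suc j) = refl

    minor₁≈minor₀ : minor (suc zero) B ≈ᴹ minor zero A
    minor₁≈minor₀ i zero    = refl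
    minor₁≈minor₀ i (suc j) = refl

    rest : ∀ {n} (A : Mat (suc (suc n))) k →
      cofactor (λ i j → A i (swap₀₁ j)) (suc (suc k)) ≈ - 1# * cofactor A (suc (suc k))
    rest {suc n} A k = begin
      cofactor (λ i j → A i (swap₀₁ j)) (suc (suc k))
        ≈⟨ *-congˡ (*-congˡ (trans (det-cong minor-swap) (det-swap-columns₀₁ (minor (suc (suc k)) A)))) ⟩
      (- 1#) ^ toℕ (suc (suc k)) * (A zero (suc (suc k)) * (- 1# * det (minor (suc (suc k)) A)))
        ≈⟨ solve 4 (λ s a e d → s :* (a :* (e :* d)) := e :* (s :* (a :* d))) refl
             ((- 1#) ^ toℕ (suc (suc k))) (A zero (suc (suc k))) (- 1#) (det (minor (suc (suc k)) A)) ⟩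
      - 1# * cofactor A (suc (suc k)) ∎
      where
      minor-swap : minor (suc (suc k)) (λ i j → A i (swap₀₁ j)) ≈ᴹ (λ i j → minor (suc (suc k)) A i (swap₀₁ j))
      minor-swap i zero          = refl
      minor-swap i (suc zero)    = refl
      minor-swap i (suc (suc j)) = refl

  -- Adjacent rows `zero` and `suc zero` are handled by transposing. Otherwise swapping these two
  -- rows moves the equal pair below row `zero`, where it lies in every minor and `det-equal-rows`
  -- applies at a smaller size.
  det-equal-row₀ : (j : Fin n) (A : Mat (suc n)) → (∀ k → A zero k ≈ A (suc j) k) → det A ≈ 0#
  det-equal-rows : {i j : Fin n} → i ≢ j → (A : Mat n) → (∀ k → A i k ≈ A j k) → det A ≈ 0#

  det-equal-row₀ zero A eq =
    trans (sym (det-transpose A)) (det-equal-columns₀₁ (transpose A) eq)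
  det-equal-row₀ (suc j) A eq = begin
    det A
      ≈⟨ -1*-1*x≈x (det A) ⟨
    - 1# * (- 1# * det A)
      ≈⟨ *-congˡ (*-congˡ (det-transpose A)) ⟨
    - 1# * (- 1# * det (transpose A))
      ≈⟨ *-congˡ (det-swap-columns₀₁ (transpose A)) ⟨
    - 1# * det (transpose (A ∘ swap₀₁))
      ≈⟨ *-congˡ (det-transpose (A ∘ swap₀₁)) ⟩
    - 1# * det (A ∘ swap₀₁)
      ≈⟨ *-congˡ (det-minors-zero (A ∘ swap₀₁) λ k →
           det-equal-rows {i = zero} {suc j} (λ ()) (minor k (A ∘ swap₀₁)) (eq ∘ punchIn k)) ⟩
    - 1# * 0#
      ≈⟨ zeroʳ _ ⟩
    0# ∎

  det-equal-rows {i = zero}  {zero}  i≢j A eq = contradiction ≡.refl i≢j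
  det-equal-rows {i = zero}  {suc j} i≢j A eq = det-equal-row₀ j A eq
  det-equal-rows {i = suc i} {zero}  i≢j A eq = det-equal-row₀ i A (sym ∘ eq)
  det-equal-rows {i = suc i} {suc j} i≢j A eq = det-minors-zero A λ k →
    det-equal-rows (i≢j ∘ ≡.cong suc) (minor k A) (eq ∘ punchIn k)

  -- Row transvections.

  -- The case distinction sits in the coefficient: all rows share one formula, additive in `A`, and
  -- `minor zero` of `addRow (suc i) (suc j) m A` computes to `addRow i j m (minor zero A)`.
  addRow : Fin n → Fin n → Carrier → Mat n → Mat n
  addRow i j m A r k = A r k + (if does (r ≟ i) then m else 0#) * A j k

  addRow-target : ∀ (i j : Fin n) m A k → addRow i j m A i k ≈ A i k + m * A j k
  addRow-target i j m A k with i ≟ i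
  ... | yes _   = refl
  ... | no  i≢i = contradiction ≡.refl i≢i

  addRow-other : ∀ (i j : Fin n) m A r → r ≢ i → ∀ k → addRow i j m A r k ≈ A r k
  addRow-other i j m A r r≢i k with r ≟ i
  ... | yes r≡i = contradiction r≡i r≢i
  ... | no  _   = trans (+-congˡ (zeroˡ _)) (+-identityʳ _)

  -- Linearity in row `i` leaves the extra term `m * det B`, where `B` is `A` with row `i`
  -- overwritten by row `j`; two equal rows make it vanish.
  det-addRow : ∀ {i j : Fin n} → i ≢ j → ∀ m A → det (addRow i j m A) ≈ det A
  det-addRow {n} {i} {j} i≢j m A = begin
    det (addRow i j m A)
      ≈⟨ det-linear i m
           (λ k → trans (addRow-target i j m A k) (+-congˡ (*-congˡ (sym (B-at-i k)))))
           (addRow-other i j m A)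
           (λ r r≢i k → trans (addRow-other i j m A r r≢i k) (sym (B-off-i r r≢i k))) ⟩
    det A + m * det B
      ≈⟨ +-congˡ (*-congˡ (det-equal-rows i≢j B λ k → trans (B-at-i k) (sym (B-off-i j (i≢j ∘ ≡.sym) k)))) ⟩
    det A + m * 0#
      ≈⟨ +-congˡ (zeroʳ m) ⟩
    det A + 0#
      ≈⟨ +-identityʳ _ ⟩
    det A ∎
    where
    B : Mat n
    B r = if does (r ≟ i) then A j else A r

    B-at-i : ∀ k → B i k ≈ A j k
    B-at-i k with i ≟ i
    ... | yes _   = refl
    ... | no  i≢i = contradiction ≡.refl i≢i

    B-off-i : ∀ r → r ≢ i → ∀ k → B r k ≈ A r k
    B-off-i r r≢i k with r ≟ i
    ... | yes r≡i = contradiction r≡i r≢i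
    ... | no  _   = refl

  -- Splitting a matrix into triangular summands.

  open Algebra.Properties.Monoid.Sum *-monoid public
    using () renaming (sum to product; sum-replicate to product-replicate)

  lowerPart : Vector Carrier n → Mat n → Mat n
  lowerPart d A zero    zero    = d zero
  lowerPart d A zero    (suc j) = 0#
  lowerPart d A (suc i) zero    = A (suc i) zero
  lowerPart d A (suc i) (suc j) = lowerPart (tail d) (minor zero A) i j

  upperPart : Vector Carrier n → Mat n → Mat n
  upperPart d A = transpose (lowerPart d (transpose A))

  det-lowerPart : ∀ (d : Vector Carrier n) A → det (lowerPart d A) ≈ product d
  det-lowerPart {zero}  d A = refl
  det-lowerPart {suc n} d A = begin
    1# * (d zero * det (lowerPart (tail d) (minor zero A)))
      + sum (λ k → (- 1#) ^ suc (toℕ k) * (0# * det (minor (suc k) (lowerPart d A))))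
      ≈⟨ +-cong (trans (*-identityˡ _) (*-congˡ (det-lowerPart (tail d) (minor zero A))))
                (sum-zero {n} _ λ k → trans (*-congˡ (zeroˡ _)) (zeroʳ _)) ⟩
    d zero * product (tail d) + 0#
      ≈⟨ +-identityʳ _ ⟩
    product d ∎

  det-upperPart : ∀ (d : Vector Carrier n) A → det (upperPart d A) ≈ product d
  det-upperPart d A =
    trans (det-transpose (lowerPart d (transpose A))) (det-lowerPart d (transpose A))

  lower+upper : ∀ (d e : Vector Carrier n) A → (∀ i → A i i ≈ d i + e i) →
                A ≈ᴹ lowerPart d A +ᴹ upperPart e A
  lower+upper d e A diag zero    zero    = diag zero
  lower+upper d e A diag zero    (suc j) = sym (+-identityˡ _)
  lower+upper d e A diag (suc i) zero    = sym (+-identityʳ _)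
  lower+upper d e A diag (suc i) (suc j) =
    lower+upper (tail d) (tail e) (minor zero A) (diag ∘ suc) i j

  sumOfTwoSL-diagonal : ∀ (d e : Vector Carrier n) {A} → (∀ i → A i i ≈ d i + e i) →
                        product d ≈ 1# → product e ≈ 1# → SumOfTwoSL A
  sumOfTwoSL-diagonal d e {A} diag Πd≈1 Πe≈1 =
    lowerPart d A , upperPart e A ,
    trans (det-lowerPart d A) Πd≈1 , trans (det-upperPart e A) Πe≈1 ,
    lower+upper d e A diag

  -- Reduction by transvections and transpositions.

  infix 4 _⇝_

  -- Column operations are row operations between two transpositions.
  data _⇝_ {n} : Mat n → Mat n → Set c where
    done : ∀ {A} → A ⇝ A
    flip : ∀ {A B} → transpose A ⇝ B → A ⇝ B
    row  : ∀ {A B i j} → i ≢ j → ∀ m → addRow i j m A ⇝ B → A ⇝ B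

  ⇝-trans : {A B C : Mat n} → A ⇝ B → B ⇝ C → A ⇝ C
  ⇝-trans done          q = q
  ⇝-trans (flip p)      q = flip (⇝-trans p q)
  ⇝-trans (row i≢j m p) q = row i≢j m (⇝-trans p q)

  -- Each step on the minor lifts with its indices shifted by one: transposition fixes the corner,
  -- and a lifted row step leaves row `zero` alone. This lets the diagonal be cleared recursively.
  ⇝-extend : ∀ (A : Mat (suc n)) {M} → minor zero A ⇝ M →
             ∃[ B ] A ⇝ B × B zero zero ≈ A zero zero × minor zero B ≡ M
  ⇝-extend A done     = A , done , refl , ≡.refl
  ⇝-extend A (flip p) with B , A⇝B , B₀₀ , eq ← ⇝-extend (transpose A) p =
    B , flip A⇝B , B₀₀ , eq
  ⇝-extend A (row {i = i} {j} i≢j m p)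
    with B , A⇝B , B₀₀ , eq ← ⇝-extend (addRow (suc i) (suc j) m A) p =
    B , row (i≢j ∘ suc-injective) m A⇝B ,
    trans B₀₀ (trans (+-congˡ (zeroˡ _)) (+-identityʳ _)) , eq

  addRow-inverse : ∀ {i j : Fin n} → i ≢ j → ∀ m A → A ≈ᴹ addRow i j (- m) (addRow i j m A)
  addRow-inverse {i = i} {j} i≢j m A r k with r ≟ i
  ... | yes _ = sym (begin
    A r k + m * A j k + - m * addRow i j m A j k
      ≈⟨ +-congˡ (*-congˡ (addRow-other i j m A j (i≢j ∘ ≡.sym) k)) ⟩
    A r k + m * A j k + - m * A j k
      ≈⟨ solve 4 (λ a m n b → a :+ m :* b :+ n :* b := a :+ (m :+ n) :* b) refl (A r k) m (- m) (A j k) ⟩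
    A r k + (m + - m) * A j k
      ≈⟨ +-congˡ (trans (*-congʳ (-‿inverseʳ m)) (zeroˡ _)) ⟩
    A r k + 0#
      ≈⟨ +-identityʳ _ ⟩
    A r k ∎)
  ... | no _ = sym (trans (+-cong (trans (+-congˡ (zeroˡ _)) (+-identityʳ _)) (zeroˡ _)) (+-identityʳ _))

  -- The inverse of each step is additive and preserves determinants, so it can be applied to the
  -- two summands of `B` separately.
  sumOfTwoSL-⇝ : {A B : Mat n} → A ⇝ B → SumOfTwoSL B → SumOfTwoSL A
  sumOfTwoSL-⇝ done     s = s
  sumOfTwoSL-⇝ (flip p) s with B , C , B∈SL , C∈SL , eq ← sumOfTwoSL-⇝ p s =
    transpose B , transpose C ,
    trans (det-transpose B) B∈SL , trans (det-transpose C) C∈SL , λ i j → eq j i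
  sumOfTwoSL-⇝ {A = A} (row {i = i} {j} i≢j m p) s
    with B , C , B∈SL , C∈SL , eq ← sumOfTwoSL-⇝ p s =
    addRow i j (- m) B , addRow i j (- m) C ,
    trans (det-addRow i≢j (- m) B) B∈SL , trans (det-addRow i≢j (- m) C) C∈SL ,
    λ r k → trans (addRow-inverse i≢j m A r k) (trans (+-cong (eq r k) (*-congˡ (eq j k)))
      (solve 5 (λ b c x b′ c′ → b :+ c :+ x :* (b′ :+ c′) := b :+ x :* b′ :+ (c :+ x :* c′)) refl
        (B r k) (C r k) (if does (r ≟ i) then - m else 0#) (B j k) (C j k)))

  -- Diagonals that split into two diagonals of product one.

  -1^even≈1 : 2 ∣ n → (- 1#) ^ n ≈ 1#
  -1^even≈1 (divides zero    ≡.refl) = refl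
  -1^even≈1 (divides (suc q) ≡.refl) = trans (-1*-1*x≈x _) (-1^even≈1 (divides q ≡.refl))

  product-1 : ∀ n → product (replicate n 1#) ≈ 1#
  product-1 n = trans (product-replicate n) (1^n≈1 n)
    where
    1^n≈1 : ∀ n → 1# ^ n ≈ 1#
    1^n≈1 zero    = refl
    1^n≈1 (suc n) = trans (*-identityˡ _) (1^n≈1 n)

  sumOfTwoSL-zeroDiagonal : {A : Mat n} → 2 ∣ n → (∀ i → A i i ≈ 0#) → SumOfTwoSL A
  sumOfTwoSL-zeroDiagonal {n} 2∣n diag =
    sumOfTwoSL-diagonal (replicate n 1#) (replicate n (- 1#))
      (λ i → trans (diag i) (sym (-‿inverseʳ 1#)))
      (product-1 n) (trans (product-replicate n) (-1^even≈1 2∣n))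

  sumOfTwoSL-2zeroDiagonal : {A : Mat (suc n)} → 2 ∣ n → A zero zero ≈ 1# + 1# →
                             (∀ i → A (suc i) (suc i) ≈ 0#) → SumOfTwoSL A
  sumOfTwoSL-2zeroDiagonal {n} 2∣n A₀₀ diag =
    sumOfTwoSL-diagonal (replicate (suc n) 1#) (1# ∷ replicate n (- 1#))
      (λ { zero → A₀₀ ; (suc i) → trans (diag i) (sym (-‿inverseʳ 1#)) })
      (product-1 (suc n)) (trans (*-identityˡ _) (trans (product-replicate n) (-1^even≈1 2∣n)))

  -- Dropping two summands at a time, a multiple of `1#` depends only on the parity of the
  -- multiplier.
  hasCharacteristic2 : ¬ 1# ≈ 0# → 1# + 1# ≈ 0# → HasCharacteristic 2
  hasCharacteristic2 1≉0 1+1≈0 m = mk⇔ (to m) from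
    where
    2+≈ : ∀ x → 1# + (1# + x) ≈ x
    2+≈ x = trans (sym (+-assoc 1# 1# x)) (trans (+-congʳ 1+1≈0) (+-identityˡ x))

    to : ∀ m → m +.× 1# ≈ 0# → 2 ∣ m
    to zero          _  = divides 0 ≡.refl
    to (suc zero)    eq = contradiction (trans (sym (+-identityʳ 1#)) eq) 1≉0
    to (suc (suc m)) eq = ∣m∣n⇒∣m+n ∣-refl (to m (trans (sym (2+≈ _)) eq))

    from : ∀ {m} → 2 ∣ m → m +.× 1# ≈ 0#
    from (divides zero    ≡.refl) = refl
    from (divides (suc q) ≡.refl) = trans (2+≈ _) (from (divides q ≡.refl))

-- Normalising the diagonal over a finite field.

module Reduction {c ℓ : Level} (F : FiniteField c ℓ) where

  open FiniteField F hiding (zero)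
  open Matrices commutativeRing
  open Determinant commutativeRing
  open Algebra.Properties.Ring ring
  open Algebra.Properties.Semiring.Exp semiring using (_^_)
  open Relation.Binary.Reasoning.Setoid setoid

  -- Finiteness gives decidable equality, on which the search for pivots rests.
  _≈?_ : Decidable _≈_
  _≈?_ = via-injection (Inverse⇒Injection finite) _≟_

  isZero? : (A : Mat n) → Dec (A ≈ᴹ 0ᴹ)
  isZero? A = all? λ i → all? λ j → A i j ≈? 0#

  nonzeroEntry : (A : Mat n) → ¬ A ≈ᴹ 0ᴹ → ∃[ i ] ∃[ j ] ¬ A i j ≈ 0#
  nonzeroEntry A A≉0 with i , Aᵢ≉0 ← ¬∀⟶∃¬ _ _ (λ i → all? λ j → A i j ≈? 0#) A≉0 =
    i , ¬∀⟶∃¬ _ _ (λ j → A i j ≈? 0#) Aᵢ≉0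

  solve-linear : ∀ a t {x} → ¬ x ≈ 0# → ∃[ m ] a + m * x ≈ t
  solve-linear a t {x} x≉0 with x⁻¹ , x⁻¹*x≈1 , _ ← invertible x x≉0 = (t - a) * x⁻¹ , (begin
    a + (t - a) * x⁻¹ * x    ≈⟨ +-congˡ (*-assoc (t - a) x⁻¹ x) ⟩
    a + (t - a) * (x⁻¹ * x)  ≈⟨ +-congˡ (trans (*-congˡ x⁻¹*x≈1) (*-identityʳ (t - a))) ⟩
    a + (t - a)              ≈⟨ +-assoc a t (- a) ⟨
    a + t - a                ≈⟨ xyx⁻¹≈y a t ⟩
    t                        ∎)

  nonzero-in-column : ∀ (A : Mat n) {r k} i → ¬ A r k ≈ 0# → ∃[ B ] A ⇝ B × ¬ B i k ≈ 0#
  nonzero-in-column A {r} {k} i Aᵣₖ≉0 with A i k ≈? 0#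
  ... | no  Aᵢₖ≉0 = A , done , Aᵢₖ≉0
  ... | yes Aᵢₖ≈0 = addRow i r 1# A , row i≢r 1# done , λ eq → Aᵣₖ≉0 (begin
    A r k               ≈⟨ *-identityˡ (A r k) ⟨
    1# * A r k          ≈⟨ +-identityˡ (1# * A r k) ⟨
    0# + 1# * A r k     ≈⟨ +-congʳ Aᵢₖ≈0 ⟨
    A i k + 1# * A r k  ≈⟨ addRow-target i r 1# A k ⟨
    addRow i r 1# A i k ≈⟨ eq ⟩
    0#                  ∎)
    where
    i≢r : i ≢ r
    i≢r ≡.refl = Aᵣₖ≉0 Aᵢₖ≈0

  -- The nonzero value is carried within column `s` to row `i`, then, in the transpose, within
  -- column `i` to row `j`.
  nonzero-at : ∀ (A : Mat n) {r s} i j → ¬ A r s ≈ 0# → ∃[ B ] A ⇝ B × ¬ B i j ≈ 0#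
  nonzero-at A i j Aᵣₛ≉0
    with B , A⇝B , Bᵢₛ≉0 ← nonzero-in-column A i Aᵣₛ≉0
    with C , Bᵀ⇝C , Cⱼᵢ≉0 ← nonzero-in-column (transpose B) j Bᵢₛ≉0 =
    transpose C , ⇝-trans A⇝B (flip (⇝-trans Bᵀ⇝C (flip done))) , Cⱼᵢ≉0

  -- A pivot just below the corner lets a multiple of row `suc zero` give the corner any value; this
  -- needs size at least two. The pivot is returned for the 2 by 2 case of `zero-diagonal`.
  set-corner : ∀ t (A : Mat (suc (suc n))) → ¬ A ≈ᴹ 0ᴹ →
               ∃[ B ] A ⇝ B × B zero zero ≈ t × ¬ B (suc zero) zero ≈ 0#
  set-corner t A A≉0 =
    let r , s , Aᵣₛ≉0 = nonzeroEntry A A≉0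
        B , A⇝B , B₁₀≉0 = nonzero-at A (suc zero) zero Aᵣₛ≉0
        m , eq = solve-linear (B zero zero) t B₁₀≉0
    in addRow zero (suc zero) m B , ⇝-trans A⇝B (row (λ ()) m done) , eq ,
       λ B₁₀≈0 → B₁₀≉0 (trans (sym (addRow-other zero (suc zero) m B (suc zero) (λ ()) zero)) B₁₀≈0)

  minor-diagonal : ∀ (A : Mat (suc n)) → ∃[ M ] minor zero A ⇝ M × (∀ i → M i i ≈ 0#) →
                   ∃[ B ] A ⇝ B × B zero zero ≈ A zero zero × (∀ i → B (suc i) (suc i) ≈ 0#)
  minor-diagonal A (M , A⇝M , diag) =
    let B , A⇝B , B₀₀≈A₀₀ , eq = ⇝-extend A A⇝M
    in B , A⇝B , B₀₀≈A₀₀ , ≡.subst (λ M → ∀ i → M i i ≈ 0#) (≡.sym eq) diag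

  zero-diagonal : (A : Mat (suc (suc n))) → ∃[ B ] A ⇝ B × (∀ i → B i i ≈ 0#)
  zero-diagonal A with isZero? A
  zero-diagonal         A | yes A≈0 = A , done , λ i → A≈0 i i
  zero-diagonal {zero}  A | no  A≉0 =
    let B , A⇝B , B₀₀≈0 , B₁₀≉0 = set-corner 0# A A≉0
        m , eq = solve-linear (B (suc zero) (suc zero)) 0# B₁₀≉0
    -- After transposing, the pivot stands in row `zero` above the last diagonal entry, which it
    -- clears without touching the corner.
    in addRow (suc zero) zero m (transpose B) , ⇝-trans A⇝B (flip (row (λ ()) m done)) ,
       λ { zero → trans (addRow-other (suc zero) zero m (transpose B) zero (λ ()) zero) B₀₀≈0
         ; (suc zero) → eq }
  zero-diagonal {suc n} A | no  A≉0 =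
    let B , A⇝B , B₀₀≈0 , _ = set-corner 0# A A≉0
        C , B⇝C , C₀₀≈B₀₀ , diag = minor-diagonal B (zero-diagonal (minor zero B))
    in C , ⇝-trans A⇝B B⇝C , λ { zero → trans C₀₀≈B₀₀ B₀₀≈0 ; (suc i) → diag i }

  -- Sums of two and of three matrices of determinant one.

  sumOfTwoSL-even : 2 ∣ suc (suc n) → (A : Mat (suc (suc n))) → SumOfTwoSL A
  sumOfTwoSL-even 2∣n A =
    let B , A⇝B , diag = zero-diagonal A
    in sumOfTwoSL-⇝ A⇝B (sumOfTwoSL-zeroDiagonal 2∣n diag)

  -- The divisibility concerns the size of the minor. `A` must be nonzero for its corner to become
  -- 2.
  sumOfTwoSL-odd : 2 ∣ suc (suc n) → (A : Mat (suc (suc (suc n)))) → ¬ A ≈ᴹ 0ᴹ → SumOfTwoSL A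
  sumOfTwoSL-odd 2∣n A A≉0 =
    let B , A⇝B , B₀₀≈2 , _ = set-corner (1# + 1#) A A≉0
        C , B⇝C , C₀₀≈B₀₀ , diag = minor-diagonal B (zero-diagonal (minor zero B))
    in sumOfTwoSL-⇝ (⇝-trans A⇝B B⇝C)
         (sumOfTwoSL-2zeroDiagonal 2∣n (trans C₀₀≈B₀₀ B₀₀≈2) diag)

  sumOfTwoSL-nonzero : (A : Mat (suc (suc n))) → ¬ A ≈ᴹ 0ᴹ → SumOfTwoSL A
  sumOfTwoSL-nonzero {n} A A≉0 with 2∣-or-pred (suc n)
  sumOfTwoSL-nonzero         A A≉0 | inj₁ 2∣n = sumOfTwoSL-even 2∣n A
  sumOfTwoSL-nonzero {zero}  A A≉0 | inj₂ 2∣n-1 = contradiction (∣1⇒≡1 2∣n-1) λ ()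
  sumOfTwoSL-nonzero {suc n} A A≉0 | inj₂ 2∣n-1 = sumOfTwoSL-odd 2∣n-1 A A≉0

  sumOfTwoSL-0 : 2 ∣ suc (suc n) ⊎ HasCharacteristic 2 → SumOfTwoSL (0ᴹ {suc (suc n)})
  sumOfTwoSL-0     (inj₁ 2∣n)   = sumOfTwoSL-even 2∣n 0ᴹ
  sumOfTwoSL-0 {n} (inj₂ char2) = sumOfTwoSL-diagonal (replicate _ 1#) (replicate _ 1#)
    -- Here 0 is the identity plus itself; the multiple 2 of `1#` unfolds to `1# + (1# + 0#)`.
    (λ i → sym (trans (+-congˡ (sym (+-identityʳ 1#))) (Equivalence.from (char2 2) ∣-refl)))
    (product-1 (suc (suc n))) (product-1 (suc (suc n)))

  -- The size `suc n` is odd and `C` is the negative of `B`, so comparing determinants gives 1 = -1,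
  -- which forces characteristic 2.
  ¬sumOfTwoSL-0 : 2 ∣ n → ¬ HasCharacteristic 2 → ¬ SumOfTwoSL (0ᴹ {suc n})
  ¬sumOfTwoSL-0 {n} 2∣n ¬char2 (B , C , B∈SL , C∈SL , 0≈B+C) =
    ¬char2 (hasCharacteristic2 1≉0 (trans (+-congˡ 1≈-1) (-‿inverseʳ 1#)))
    where
    1≈-1 : 1# ≈ - 1#
    1≈-1 = begin
      1#                              ≈⟨ C∈SL ⟨
      det C                           ≈⟨ det-cong (λ i j → trans
                                           (+-inverseʳ-unique (B i j) (C i j) (sym (0≈B+C i j)))
                                           (sym (-1*x≈-x (B i j)))) ⟩
      det (λ i j → - 1# * B i j)      ≈⟨ det-scale (- 1#) B ⟩
      - 1# * (- 1#) ^ n * det B       ≈⟨ *-cong (*-congˡ (-1^even≈1 2∣n)) B∈SL ⟩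
      - 1# * 1# * 1#                  ≈⟨ trans (*-identityʳ _) (*-identityʳ _) ⟩
      - 1#                            ∎

  -- The identity matrix is written as a `lowerPart` so that `det-lowerPart` gives its determinant.
  1ᴹ -1ᴹ : Mat n
  1ᴹ      = lowerPart (replicate _ 1#) 0ᴹ
  -1ᴹ i j = - 1ᴹ i j

  -1ᴹ≉0ᴹ : ¬ -1ᴹ {suc n} ≈ᴹ 0ᴹ
  -1ᴹ≉0ᴹ -1≈0 = 1≉0 (-‿injective (trans (-1≈0 zero zero) (sym -0#≈0#)))

  1ᴹ∈SL : ∀ n → SL n 1ᴹ
  1ᴹ∈SL n = trans (det-lowerPart {n} (replicate n 1#) 0ᴹ) (product-1 n)

  -- The nonzero matrix `-1ᴹ` is a sum of two; adding `1ᴹ` as a third summand gives zero.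
  sumOfThreeSL-0 : SumOfThreeSL (0ᴹ {suc (suc n)})
  sumOfThreeSL-0 {n} =
    let B , C , B∈SL , C∈SL , eq = sumOfTwoSL-nonzero -1ᴹ -1ᴹ≉0ᴹ
    in B , C , 1ᴹ , B∈SL , C∈SL , 1ᴹ∈SL (suc (suc n)) ,
       λ i j → trans (sym (-‿inverseˡ (1ᴹ i j))) (+-congʳ (eq i j))

theorem3p10 : {c ℓ : Level} (F : FiniteField c ℓ) (n : ℕ) → 2 ≤ n →
    let open Matrices (FiniteField.commutativeRing F) in
    ((A : Mat n) → ¬ (A ≈ᴹ 0ᴹ) → SumOfTwoSL A)
    × ((2 ∣ n) ⊎ HasCharacteristic 2 → SumOfTwoSL (0ᴹ {n}))
    × (¬ ((2 ∣ n) ⊎ HasCharacteristic 2) →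
    (¬ SumOfTwoSL (0ᴹ {n})) × SumOfThreeSL (0ᴹ {n}))
theorem3p10 F (suc zero)    (s≤s ())
theorem3p10 F (suc (suc n)) _ =
  sumOfTwoSL-nonzero , sumOfTwoSL-0 , λ odd → ¬sumOfTwoSL-0 (2∣-pred (odd ∘ inj₁)) (odd ∘ inj₂) , sumOfThreeSL-0
  where open Reduction F
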